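{- Let $n\ge 2$ and $d\ge 2$ be integers, and let $G$ be a graph on $n$ vertices with no isolated vertex such that the maximum degree of the complement $\overline{G}$ equals $d-1$. Then $$\mathrm{scc}(G)\le (e^2+1)\,n\,d\left\lceil \ln\left(\frac{n-1}{d-1}\right)\right\rceil.$$
   Context: All graphs are finite, simple and undirected; $\overline{G}$ denotes the complement of $G$. A clique of $G$ is a set of pairwise adjacent vertices, and a clique covering of $G$ is a family of cliques such that every edge of $G$ lies in at least one of them. $\mathrm{scc}(G)$ is the minimum of $\sum_{C\in\mathcal{C}}|C|$ over all clique coverings $\mathcal{C}$ of $G$. -}

module Defs where

open import Data.Bool using (Bool; true; false; not; _∧_)
open import Data.Nat using (ℕ; zero; suc; _*_; _^_; _!; _≤_; _∸_; NonZero)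
open import Data.Nat.Properties using (_!≢0)
open import Data.Fin using (Fin)
open import Data.Fin.Properties using (_≟_)
open import Data.Fin.Subset using (Subset; _∈_; ∣_∣)
open import Data.Vec using (tabulate)
open import Data.List using (List; map)
open import Data.Nat.ListAction using (sum)
open import Data.List.Relation.Unary.All using (All)
open import Data.List.Relation.Unary.Any using (Any)
open import Data.Product using (∃; Σ; _×_; _,_)
open import Data.Integer using (+_)
open import Data.Rational as ℚ using (ℚ)
open import Relation.Nullary using (¬_)
open import Relation.Nullary.Decidable using (⌊_⌋)
open import Relation.Binary.PropositionalEquality using (_≡_; _≢_)

record Graph (n : ℕ) : Set where
  field
    adj   : Fin n → Fin n → Bool
    sym   : ∀ u v → adj u v ≡ adj v u
    irrefl : ∀ u → adj u u ≡ false
open Graph public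

Edge : ∀ {n} → Graph n → Fin n → Fin n → Set
Edge G u v = adj G u v ≡ true

coNbhd : ∀ {n} → Graph n → Fin n → Subset n
coNbhd G u = tabulate (λ v → not (adj G u v) ∧ not ⌊ u ≟ v ⌋)

coDeg : ∀ {n} → Graph n → Fin n → ℕ
coDeg G u = ∣ coNbhd G u ∣

MaxCoDegIs : ∀ {n} → Graph n → ℕ → Set
MaxCoDegIs G m = (∀ u → coDeg G u ≤ m) × ∃ λ u → coDeg G u ≡ m

NoIsolated : ∀ {n} → Graph n → Set
NoIsolated {n} G = ∀ (u : Fin n) → ∃ λ v → Edge G u v

IsClique : ∀ {n} → Graph n → Subset n → Set
IsClique G C = ∀ u v → u ∈ C → v ∈ C → u ≢ v → Edge G u v

IsCliqueCovering : ∀ {n} → Graph n → List (Subset n) → Set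
IsCliqueCovering G 𝒞 =
  All (IsClique G) 𝒞 ×
  (∀ u v → Edge G u v → Any (λ C → u ∈ C × v ∈ C) 𝒞)

weight : ∀ {n} → List (Subset n) → ℕ
weight 𝒞 = sum (map ∣_∣ 𝒞)

expPartial : ℕ → ℕ → ℚ
expPartial k zero    = ℚ.1ℚ
expPartial k (suc N) = expPartial k N ℚ.+ term
  where
  instance _ = (suc N) !≢0
  term = (+ (k ^ suc N)) ℚ./ (suc N !)

-- For naturals a, b > 0 and k ∈ ℕ:  a / b ≤ e^k   (stated as a ≤ b · e^k).
-- (Faithful because e^k is irrational for k ≥ 1, so a ≤ b e^k iff
--  a ≤ b S_N for some partial sum S_N; for k = 0 all S_N equal 1 = e^0.)
FracLeExp : ℕ → ℕ → ℕ → Set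
FracLeExp a b k = ∃ λ N → (+ a) ℚ./ 1 ℚ.≤ ((+ b) ℚ./ 1) ℚ.* expPartial k N

IsCeilLn : ℕ → ℕ → ℕ → Set
IsCeilLn a b L = FracLeExp a b L × (∀ k → FracLeExp a b k → L ≤ k)

-- For natural s, M:  s ≤ (e² + 1) · M.
-- (s ≤ (e²+1)M iff s ≤ (S_N + 1) M for some partial sum S_N of e²,
--  as e² is irrational and the partial sums increase strictly to e².)
LeE2Plus1Times : ℕ → ℕ → Set
LeE2Plus1Times s M =
  ∃ λ N → (+ s) ℚ./ 1 ℚ.≤ (expPartial 2 N ℚ.+ ℚ.1ℚ) ℚ.* ((+ M) ℚ./ 1)

-- scc(G) ≤ B (B given as a predicate "s ≤ B" on naturals):
-- since scc is a minimum, this is existence of a covering of weight ≤ B.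
SccBounded : ∀ {n} → Graph n → (ℕ → Set) → Set
SccBounded G Bound = ∃ λ 𝒞 → IsCliqueCovering G 𝒞 × Bound (weight 𝒞)

{-# OPTIONS --safe #-}
module Submission where

-- Put m = d − 1.  Choose every vertex with probability 1/d and discard the chosen
-- vertices that have a chosen non-neighbour.  What is kept is a clique of expected size
-- at most n/d, and it contains a given edge with probability at least
-- q = (1/d)² (1 − 1/d)²ᵐ, since only the non-neighbours of its two ends matter.
-- Averaging derandomises this: t rounds cost at most tn/d and leave at most
-- (1 − q)ᵗ |E| edges, each of which
-- is covered by itself.  For t = ⌊L/q⌋ + 1 we have
-- (1 − q)ᵗ ≤ e⁻ᴸ ≤ m/(n − 1), so that the left-over edges cost at most nm, and
-- 1/q = d² (1 + 1/m)²ᵐ ≤ d² e².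
-- No limits are needed: (1 − x) S(y + x) ≤ S(y) holds for every Taylor polynomial S of exp.

open import Defs
open import Data.Nat using (ℕ; _≤_; _*_; _∸_)
open import Data.Bool using (Bool; true; false; not; _∧_)
import Data.Bool.Properties as Bool
open import Data.Fin using (Fin; zero; suc)
open import Data.Fin.Properties using (_≟_)
open import Data.Fin.Subset using (Subset; inside; outside; _∈_; _∉_; _⊆_; _⊂_; _∪_; _∩_; _-_; ⁅_⁆; ⊤; ∣_∣; Nonempty)
open import Data.Fin.Subset.Properties
import Data.Integer as ℤ
import Data.Integer.Properties as ℤ
open import Data.List using (List; []; _∷_; _++_; map; filter; length; allFin)
open import Data.List.Membership.Propositional using () renaming (_∈_ to _∈ₗ_)
open import Data.List.Membership.Propositional.Properties using (∈-filter⁺; ∈-++⁺ˡ; ∈-++⁺ʳ; ∈-map⁺; ∈-allFin)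
open import Data.List.Properties using (length-map; length-++; length-tabulate; length-filter)
open import Data.List.Relation.Unary.All as All using (All; []; _∷_)
import Data.List.Relation.Unary.All.Properties as All
open import Data.List.Relation.Unary.Any as Any using (Any; here; there)
open import Data.Nat using (zero; suc; _+_; _^_; _!; _<_; _/_; z≤n; s≤s; s≤s⁻¹; NonZero; >-nonZero)
open import Data.Nat.DivMod using (m/n*n≤m; m≡m%n+[m/n]*n; m%n<n)
open import Data.Nat.Properties hiding (_≟_)
open import Data.Nat.Tactic.RingSolver using (solve-∀)
open import Data.Product using (∃; _×_; _,_; proj₁; proj₂; map₂; swap)
open import Data.Rational as ℚ using (toℚᵘ)
import Data.Rational.Properties as ℚ
open import Data.Rational.Unnormalised as ℚᵘ using (ℚᵘ; mkℚᵘ; *≡*; *≤*)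
import Data.Rational.Unnormalised.Properties as ℚᵘ
open import Data.Sum as Sum using (_⊎_; inj₁; inj₂)
open import Data.Vec using ([]; _∷_; tabulate; here; there)
open import Data.Vec.Properties using (lookup∘tabulate; []=⇒lookup; lookup⇒[]=)
open import Function using (_∘_; id)
open import Relation.Binary.PropositionalEquality using (_≡_; _≢_; refl; cong; cong₂; subst; subst₂; trans; module ≡-Reasoning)
  renaming (sym to ≡-sym)
open import Relation.Nullary using (Dec; does; yes; no; ¬_; ¬?; contradiction; _×-dec_)
open import Relation.Nullary.Decidable using (dec-true; dec-false; isYes≗does)

-- Taylor polynomials of the exponential function

-- N! bᴺ times the N-th Taylor polynomial of exp at u / b.
expSum : ℕ → ℕ → ℕ → ℕ
expSum b zero    u = 1
expSum b (suc N) u = suc N * b * expSum b N u + u ^ suc N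

-- A mean value inequality: between `u` and `a + u` the derivative of the power is largest at the
-- right end. The lower counterpart takes the left end.
^-step-upper : ∀ a u k → (a + u) ^ suc k ≤ u ^ suc k + suc k * a * (a + u) ^ k
^-step-upper a u zero = ≤-reflexive (eq a u)
  where
  eq : ∀ a u → (a + u) * 1 ≡ u * 1 + 1 * a * 1
  eq = solve-∀
^-step-upper a u (suc k) = begin
  (a + u) * X                                 ≡⟨ *-distribʳ-+ X a u ⟩
  a * X + u * X                               ≤⟨ +-monoʳ-≤ (a * X) (*-monoʳ-≤ u (^-step-upper a u k)) ⟩
  a * X + u * (u ^ suc k + suc k * a * Y)     ≡⟨ eq₁ a u X Y (u ^ suc k) (suc k) ⟩
  a * X + u * u ^ suc k + suc k * a * (u * Y) ≤⟨ +-monoʳ-≤ (a * X + u * u ^ suc k) (*-monoʳ-≤ (suc k * a) (*-monoˡ-≤ Y (m≤n+m u a))) ⟩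
  a * X + u * u ^ suc k + suc k * a * X       ≡⟨ eq₂ a X (u * u ^ suc k) (suc k) ⟩
  u * u ^ suc k + (1 + suc k) * a * X         ∎
  where
  open ≤-Reasoning
  Y = (a + u) ^ k
  X = (a + u) ^ suc k
  eq₁ : ∀ a u X Y Z k → a * X + u * (Z + k * a * Y) ≡ a * X + u * Z + k * a * (u * Y)
  eq₁ = solve-∀
  eq₂ : ∀ a X Z k → a * X + Z + k * a * X ≡ Z + (1 + k) * a * X
  eq₂ = solve-∀

^-step-lower : ∀ a u k → u ^ suc k + suc k * a * u ^ k ≤ (a + u) ^ suc k
^-step-lower a u zero = ≤-reflexive (eq a u)
  where
  eq : ∀ a u → u * 1 + 1 * a * 1 ≡ (a + u) * 1
  eq = solve-∀
^-step-lower a u (suc k) = begin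
  u * (u * Y) + (1 + suc k) * a * (u * Y)                     ≤⟨ m≤m+n _ (a * (suc k * a * Y)) ⟩
  u * (u * Y) + (1 + suc k) * a * (u * Y) + a * (suc k * a * Y) ≡⟨ eq a u Y (suc k) ⟩
  (a + u) * (u * Y + suc k * a * Y)                           ≤⟨ *-monoʳ-≤ (a + u) (^-step-lower a u k) ⟩
  (a + u) * (a + u) ^ suc k                                   ∎
  where
  open ≤-Reasoning
  Y = u ^ k
  eq : ∀ a u Y k → u * (u * Y) + (1 + k) * a * (u * Y) + a * (k * a * Y) ≡ (a + u) * (u * Y + k * a * Y)
  eq = solve-∀

-- The derivative of a Taylor polynomial of exp is the preceding one. Adding up the power bounds
-- over all degrees therefore gives a mean value inequality with the derivative taken at the right
-- end.
expSum-step-upper : ∀ a b u N → expSum b (suc N) (a + u) ≤ expSum b (suc N) u + suc N * a * expSum b N (a + u)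
expSum-step-upper a b u zero = ≤-reflexive (eq a b u)
  where
  eq : ∀ a b u → 1 * b * 1 + (a + u) * 1 ≡ 1 * b * 1 + u * 1 + 1 * a * 1
  eq = solve-∀
expSum-step-upper a b u (suc N) = begin
  k₂ * b * expSum b (suc N) (a + u) + (a + u) ^ k₂
    ≤⟨ +-mono-≤ (*-monoʳ-≤ (k₂ * b) (expSum-step-upper a b u N)) (^-step-upper a u (suc N)) ⟩
  k₂ * b * (expSum b (suc N) u + suc N * a * expSum b N (a + u)) + (u ^ k₂ + k₂ * a * (a + u) ^ suc N)
    ≡⟨ eq k₂ (suc N) a b (expSum b (suc N) u) (expSum b N (a + u)) (u ^ k₂) ((a + u) ^ suc N) ⟩
  k₂ * b * expSum b (suc N) u + u ^ k₂ + k₂ * a * (suc N * b * expSum b N (a + u) + (a + u) ^ suc N) ∎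
  where
  open ≤-Reasoning
  k₂ = suc (suc N)
  eq : ∀ k l a b P Q X Y → k * b * (P + l * a * Q) + (X + k * a * Y) ≡ k * b * P + X + k * a * (l * b * Q + Y)
  eq = solve-∀

expSum-step-lower : ∀ a b u N → expSum b (suc N) u + suc N * a * expSum b N u ≤ expSum b (suc N) (a + u)
expSum-step-lower a b u zero = ≤-reflexive (eq a b u)
  where
  eq : ∀ a b u → 1 * b * 1 + u * 1 + 1 * a * 1 ≡ 1 * b * 1 + (a + u) * 1
  eq = solve-∀
expSum-step-lower a b u (suc N) = begin
  k₂ * b * expSum b (suc N) u + u ^ k₂ + k₂ * a * (suc N * b * expSum b N u + u ^ suc N)
    ≡⟨ eq k₂ (suc N) a b (expSum b (suc N) u) (expSum b N u) (u ^ k₂) (u ^ suc N) ⟩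
  k₂ * b * (expSum b (suc N) u + suc N * a * expSum b N u) + (u ^ k₂ + k₂ * a * u ^ suc N)
    ≤⟨ +-mono-≤ (*-monoʳ-≤ (k₂ * b) (expSum-step-lower a b u N)) (^-step-lower a u (suc N)) ⟩
  k₂ * b * expSum b (suc N) (a + u) + (a + u) ^ k₂ ∎
  where
  open ≤-Reasoning
  k₂ = suc (suc N)
  eq : ∀ k l a b P Q X Y → k * b * P + X + k * a * (l * b * Q + Y) ≡ k * b * (P + l * a * Q) + (X + k * a * Y)
  eq = solve-∀

-- (1 − x) S_N(y + x) ≤ S_N(y) for x = a / (a + c).
expSum-decay : ∀ a c u N → c * expSum (a + c) N (a + u) ≤ (a + c) * expSum (a + c) N u
expSum-decay a c u zero    = *-monoˡ-≤ 1 (m≤n+m c a)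
expSum-decay a c u (suc N) = +-cancelˡ-≤ (a * P′) (c * P′) _ (begin
  a * P′ + c * P′                          ≡⟨ *-distribʳ-+ P′ a c ⟨
  b * P′                                   ≤⟨ *-monoʳ-≤ b (expSum-step-upper a b u N) ⟩
  -- The added top-degree term completes `suc N * b * Q′` to `P′`, so that the derivative is bounded
  -- by the polynomial itself.
  b * (P + suc N * a * Q′)                 ≤⟨ m≤m+n _ (a * (a + u) ^ suc N) ⟩
  b * (P + suc N * a * Q′) + a * (a + u) ^ suc N
                                           ≡⟨ eq a b P Q′ (suc N) ((a + u) ^ suc N) ⟩
  a * P′ + b * P                           ∎)
  where
  open ≤-Reasoning
  b = a + c
  P = expSum b (suc N) u
  P′ = expSum b (suc N) (a + u)
  Q′ = expSum b N (a + u)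
  eq : ∀ a b P Q k X → b * (P + k * a * Q) + a * X ≡ a * (k * b * Q + X) + b * P
  eq = solve-∀

expSum-0 : ∀ b N → expSum b N 0 ≡ N ! * b ^ N
expSum-0 b zero    = refl
expSum-0 b (suc N) rewrite expSum-0 b N = eq (suc N) b (N !) (b ^ N)
  where
  eq : ∀ k b F X → k * b * (F * X) + 0 ≡ k * F * (b * X)
  eq = solve-∀

-- Starting from argument 0, each increase by `a` costs one factor `c / (a + c)`. The last factor on
-- the right is the value at 0.
expSum-iterated-decay : ∀ a c N t → c ^ t * expSum (a + c) N (t * a) ≤ (a + c) ^ t * (N ! * (a + c) ^ N)
expSum-iterated-decay a c N zero rewrite expSum-0 (a + c) N = ≤-refl
expSum-iterated-decay a c N (suc t) = begin
  c * c ^ t * expSum b N (a + t * a)   ≡⟨ eq₁ c (c ^ t) (expSum b N (a + t * a)) ⟩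
  c ^ t * (c * expSum b N (a + t * a)) ≤⟨ *-monoʳ-≤ (c ^ t) (expSum-decay a c (t * a) N) ⟩
  c ^ t * (b * expSum b N (t * a))     ≡⟨ eq₂ (c ^ t) b (expSum b N (t * a)) ⟩
  b * (c ^ t * expSum b N (t * a))     ≤⟨ *-monoʳ-≤ b (expSum-iterated-decay a c N t) ⟩
  b * (b ^ t * (N ! * b ^ N))          ≡⟨ *-assoc b _ _ ⟨
  b * b ^ t * (N ! * b ^ N)            ∎
  where
  open ≤-Reasoning
  b = a + c
  eq₁ : ∀ c C X → c * C * X ≡ C * (c * X)
  eq₁ = solve-∀
  eq₂ : ∀ C b X → C * (b * X) ≡ b * (C * X)
  eq₂ = solve-∀

^-distribʳ-* : ∀ k m n → (m * n) ^ k ≡ m ^ k * n ^ k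
^-distribʳ-* zero    m n = refl
^-distribʳ-* (suc k) m n rewrite ^-distribʳ-* k m n = eq m n (m ^ k) (n ^ k)
  where
  eq : ∀ m n X Y → m * n * (X * Y) ≡ m * X * (n * Y)
  eq = solve-∀

-- `expSum` is homogeneous of degree `N` in denominator and numerator together. This brings the
-- working denominator down to 1, the form that matches the rational partial sums.
expSum-scale : ∀ s N u → expSum s N (u * s) ≡ s ^ N * expSum 1 N u
expSum-scale s zero    u = refl
expSum-scale s (suc N) u rewrite expSum-scale s N u | ^-distribʳ-* (suc N) u s =
  eq (suc N) s (s ^ N) (expSum 1 N u) (u ^ suc N)
  where
  eq : ∀ k s X P Y → k * s * (X * P) + Y * (s * X) ≡ s * X * (k * 1 * P + Y)
  eq = solve-∀

expSum-monoʳ-≤ : ∀ b N {u v} → u ≤ v → expSum b N u ≤ expSum b N v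
expSum-monoʳ-≤ b zero    u≤v = ≤-refl
expSum-monoʳ-≤ b (suc N) u≤v = +-mono-≤ (*-monoʳ-≤ (suc N * b) (expSum-monoʳ-≤ b N u≤v)) (^-monoˡ-≤ (suc N) u≤v)

-- (1 − a/b)ᵗ e^L ≤ 1 for b = a + c and t a ≥ L b.
exp-decay : ∀ a c L N t .{{_ : NonZero (a + c)}} → L * (a + c) ≤ t * a →
            c ^ t * expSum 1 N L ≤ (a + c) ^ t * N !
exp-decay a c L N t Lb≤ta = *-cancelʳ-≤ _ _ (b ^ N) {{m^n≢0 b N}} (begin
  c ^ t * expSum 1 N L * b ^ N   ≡⟨ eq (c ^ t) (expSum 1 N L) (b ^ N) ⟩
  c ^ t * (b ^ N * expSum 1 N L) ≡⟨ cong (c ^ t *_) (expSum-scale b N L) ⟨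
  c ^ t * expSum b N (L * b)     ≤⟨ *-monoʳ-≤ (c ^ t) (expSum-monoʳ-≤ b N Lb≤ta) ⟩
  c ^ t * expSum b N (t * a)     ≤⟨ expSum-iterated-decay a c N t ⟩
  b ^ t * (N ! * b ^ N)          ≡⟨ *-assoc (b ^ t) _ _ ⟨
  b ^ t * N ! * b ^ N            ∎)
  where
  open ≤-Reasoning
  b = a + c
  eq : ∀ C P X → C * P * X ≡ C * (X * P)
  eq = solve-∀

-- (1 + 1/m)ᵗ ≤ S_t(t/m).
!*suc^≤expSum : ∀ m t → t ! * suc m ^ t ≤ expSum m t t
!*suc^≤expSum m zero    = ≤-refl
!*suc^≤expSum m (suc t) = begin
  suc t * t ! * (suc m * suc m ^ t)             ≡⟨ eq₁ (suc t) (t !) m (suc m ^ t) ⟩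
  suc t * (suc m * (t ! * suc m ^ t))           ≤⟨ *-monoʳ-≤ (suc t) (*-monoʳ-≤ (suc m) (!*suc^≤expSum m t)) ⟩
  -- Adding `t ^ suc t` raises the degree to `suc t`; moving the argument from t/m to (t + 1)/m then
  -- supplies the 1/m in the factor 1 + 1/m.
  suc t * (suc m * expSum m t t)                ≤⟨ m≤m+n _ (t ^ suc t) ⟩
  suc t * (suc m * expSum m t t) + t ^ suc t    ≡⟨ eq₂ (suc t) m (expSum m t t) (t ^ suc t) ⟩
  expSum m (suc t) t + suc t * 1 * expSum m t t ≤⟨ expSum-step-lower 1 m t t ⟩
  expSum m (suc t) (suc t)                      ∎
  where
  open ≤-Reasoning
  eq₁ : ∀ k F m X → k * F * ((1 + m) * X) ≡ k * ((1 + m) * (F * X))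
  eq₁ = solve-∀
  eq₂ : ∀ k m P X → k * ((1 + m) * P) + X ≡ k * m * P + X + k * 1 * P
  eq₂ = solve-∀

-- The choice t = 2m makes the argument t/m equal to 2, and homogeneity clears the denominator `m`.
-- This is the source of e² in the theorem.
[1+1/m]^2m≤exp2 : ∀ m → (2 * m) ! * suc m ^ (2 * m) ≤ m ^ (2 * m) * expSum 1 (2 * m) 2
[1+1/m]^2m≤exp2 m = subst ((2 * m) ! * suc m ^ (2 * m) ≤_) (expSum-scale m (2 * m) 2) (!*suc^≤expSum m (2 * m))


-- Comparison with the rational partial sums

infix 8 _∕_
-- Unnormalised fractions, because their order and equality are cross-multiplication and no gcd has
-- to be handled.
_∕_ : (a f : ℕ) .{{_ : NonZero f}} → ℚᵘ
a ∕ f = (ℤ.+ a) ℚᵘ./ f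

∕-cong : ∀ {a b f g} .{{_ : NonZero f}} .{{_ : NonZero g}} → a * g ≡ b * f → a ∕ f ℚᵘ.≃ b ∕ g
∕-cong {a} {b} {suc f} {suc g} eq = *≡* (subst₂ _≡_ (ℤ.pos-* a (suc g)) (ℤ.pos-* b (suc f)) (cong ℤ.+_ eq))

∕-≤⁺ : ∀ {a b f g} .{{_ : NonZero f}} .{{_ : NonZero g}} → a * g ≤ b * f → a ∕ f ℚᵘ.≤ b ∕ g
∕-≤⁺ {a} {b} {suc f} {suc g} le = *≤* (subst₂ ℤ._≤_ (ℤ.pos-* a (suc g)) (ℤ.pos-* b (suc f)) (ℤ.+≤+ le))

∕-≤⁻ : ∀ {a b f g} .{{_ : NonZero f}} .{{_ : NonZero g}} → a ∕ f ℚᵘ.≤ b ∕ g → a * g ≤ b * f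
∕-≤⁻ {a} {b} {suc f} {suc g} (*≤* le) =
  ℤ.drop‿+≤+ (subst₂ ℤ._≤_ (≡-sym (ℤ.pos-* a (suc g))) (≡-sym (ℤ.pos-* b (suc f))) le)

∕-+ : ∀ a b f g .{{_ : NonZero f}} .{{_ : NonZero g}} → a ∕ f ℚᵘ.+ b ∕ g ≡ ((a * g + b * f) ∕ (f * g)) {{m*n≢0 f g}}
∕-+ a b (suc f) (suc g) =
  cong (ℚᵘ._/ (suc f * suc g)) (≡-sym (cong₂ ℤ._+_ (ℤ.pos-* a (suc g)) (ℤ.pos-* b (suc f))))

∕-* : ∀ a b f g .{{_ : NonZero f}} .{{_ : NonZero g}} → a ∕ f ℚᵘ.* b ∕ g ≡ ((a * b) ∕ (f * g)) {{m*n≢0 f g}}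
∕-* a b (suc f) (suc g) = cong (ℚᵘ._/ (suc f * suc g)) (≡-sym (ℤ.pos-* a b))

toℚᵘ-/ : ∀ a f .{{_ : NonZero f}} → toℚᵘ ((ℤ.+ a) ℚ./ f) ℚᵘ.≃ a ∕ f
toℚᵘ-/ a (suc f) = ℚ.toℚᵘ-fromℚᵘ (mkℚᵘ (ℤ.+ a) f)

expPartial≃ : ∀ k N → toℚᵘ (expPartial k N) ℚᵘ.≃ (expSum 1 N k ∕ (N !)) {{N !≢0}}
expPartial≃ k zero    = ℚᵘ.≃-refl
expPartial≃ k (suc N) = begin
  toℚᵘ (expPartial k (suc N))                         ≈⟨ ℚ.toℚᵘ-homo-+ (expPartial k N) _ ⟩
  toℚᵘ (expPartial k N) ℚᵘ.+ toℚᵘ ((ℤ.+ (k ^ suc N)) ℚ./ (suc N !))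
    ≈⟨ ℚᵘ.+-cong (expPartial≃ k N) (toℚᵘ-/ (k ^ suc N) (suc N !)) ⟩
  expSum 1 N k ∕ (N !) ℚᵘ.+ (k ^ suc N) ∕ (suc N !)   ≡⟨ ∕-+ (expSum 1 N k) (k ^ suc N) (N !) (suc N !) ⟩
  (expSum 1 N k * suc N ! + k ^ suc N * N !) ∕ (N ! * suc N !)
    ≈⟨ ∕-cong (eq (suc N) (N !) (expSum 1 N k) (k ^ suc N)) ⟩
  expSum 1 (suc N) k ∕ (suc N !)                      ∎
  where
  open ℚᵘ.≃-Reasoning
  instance
    _ = N !≢0
    _ = suc N !≢0
    _ = m*n≢0 (N !) (suc N !)
  eq : ∀ n F P X → (P * (n * F) + X * F) * (n * F) ≡ (n * 1 * P + X) * (F * (n * F))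
  eq = solve-∀

-- Here the hypothesis on L enters natural-number arithmetic; `≤⇒LeE2Plus1Times` is the way back.
-- All estimates between the two are over ℕ.
FracLeExp⇒≤ : ∀ {a b k} → FracLeExp a b k → ∃ λ N → a * N ! ≤ b * expSum 1 N k
FracLeExp⇒≤ {a} {b} {k} (N , le) = N , (begin
  a * N !                  ≡⟨ cong (a *_) (*-identityˡ (N !)) ⟨
  a * (1 * N !)            ≤⟨ ∕-≤⁻ le′ ⟩
  b * expSum 1 N k * 1     ≡⟨ *-identityʳ _ ⟩
  b * expSum 1 N k         ∎)
  where
  open ≤-Reasoning
  instance
    _ = N !≢0
    _ = m*n≢0 1 (N !)
  le′ : a ∕ 1 ℚᵘ.≤ (b * expSum 1 N k) ∕ (1 * N !)
  le′ = ℚᵘ.≤-respʳ-≃ (ℚᵘ.≃-trans (ℚ.toℚᵘ-homo-* ((ℤ.+ b) ℚ./ 1) (expPartial k N))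
          (ℚᵘ.≃-trans (ℚᵘ.*-cong (toℚᵘ-/ b 1) (expPartial≃ k N)) (ℚᵘ.≃-reflexive (∕-* b (expSum 1 N k) 1 (N !)))))
        (ℚᵘ.≤-respˡ-≃ (toℚᵘ-/ a 1) (ℚ.toℚᵘ-mono-≤ le))

≤⇒LeE2Plus1Times : ∀ {s M} N → s * N ! ≤ (expSum 1 N 2 + N !) * M → LeE2Plus1Times s M
≤⇒LeE2Plus1Times {s} {M} N le = N , ℚ.toℚᵘ-cancel-≤ (begin
  toℚᵘ ((ℤ.+ s) ℚ./ 1)                                  ≃⟨ toℚᵘ-/ s 1 ⟩
  s ∕ 1                                               ≤⟨ ∕-≤⁺ (subst₂ _≤_ (eq₁ s (N !)) (eq₂ (expSum 1 N 2) (N !) M) le) ⟩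
  ((P * 1 + 1 * N !) * M) ∕ (N ! * 1 * 1)             ≡⟨ ∕-* (P * 1 + 1 * N !) M (N ! * 1) 1 ⟨
  (P * 1 + 1 * N !) ∕ (N ! * 1) ℚᵘ.* M ∕ 1            ≡⟨ cong (ℚᵘ._* M ∕ 1) (∕-+ P 1 (N !) 1) ⟨
  (P ∕ (N !) ℚᵘ.+ 1 ∕ 1) ℚᵘ.* M ∕ 1
    ≃⟨ ℚᵘ.*-cong (ℚᵘ.≃-trans (ℚ.toℚᵘ-homo-+ (expPartial 2 N) ℚ.1ℚ) (ℚᵘ.+-cong (expPartial≃ 2 N) ℚᵘ.≃-refl)) (toℚᵘ-/ M 1) ⟨
  toℚᵘ (expPartial 2 N ℚ.+ ℚ.1ℚ) ℚᵘ.* toℚᵘ ((ℤ.+ M) ℚ./ 1) ≃⟨ ℚ.toℚᵘ-homo-* (expPartial 2 N ℚ.+ ℚ.1ℚ) ((ℤ.+ M) ℚ./ 1) ⟨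
  toℚᵘ ((expPartial 2 N ℚ.+ ℚ.1ℚ) ℚ.* ((ℤ.+ M) ℚ./ 1))  ∎)
  where
  open ℚᵘ.≤-Reasoning
  P = expSum 1 N 2
  instance
    _ = N !≢0
    _ = m*n≢0 (N !) 1
    _ = m*n≢0 (N ! * 1) 1
  eq₁ : ∀ s F → s * F ≡ s * (F * 1 * 1)
  eq₁ = solve-∀
  eq₂ : ∀ P F M → (P + F) * M ≡ (P * 1 + 1 * F) * M * 1
  eq₂ = solve-∀

-- Averages over random subsets

-- (m + 1)ⁿ times the expectation of g over a random subset that contains each
-- element independently with probability 1 / (m + 1).
total : ∀ m {n} → (Subset n → ℕ) → ℕ
total m {zero}  g = g []
total m {suc n} g = total m (g ∘ (inside ∷_)) + m * total m (g ∘ (outside ∷_))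

total-mono-≤ : ∀ m {n} {f g : Subset n → ℕ} → (∀ S → f S ≤ g S) → total m f ≤ total m g
total-mono-≤ m {zero}  f≤g = f≤g []
total-mono-≤ m {suc n} f≤g =
  +-mono-≤ (total-mono-≤ m (f≤g ∘ (inside ∷_))) (*-monoʳ-≤ m (total-mono-≤ m (f≤g ∘ (outside ∷_))))

total-+ : ∀ m {n} (f g : Subset n → ℕ) → total m (λ S → f S + g S) ≡ total m f + total m g
total-+ m {zero}  f g = refl
total-+ m {suc n} f g
  rewrite total-+ m (f ∘ (inside ∷_)) (g ∘ (inside ∷_)) | total-+ m (f ∘ (outside ∷_)) (g ∘ (outside ∷_)) =
  eq m (total m (f ∘ (inside ∷_))) (total m (g ∘ (inside ∷_))) (total m (f ∘ (outside ∷_))) (total m (g ∘ (outside ∷_)))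
  where
  eq : ∀ m a b c d → a + b + m * (c + d) ≡ a + m * c + (b + m * d)
  eq = solve-∀

total-* : ∀ m k {n} (f : Subset n → ℕ) → total m (λ S → k * f S) ≡ k * total m f
total-* m k {zero}  f = refl
total-* m k {suc n} f
  rewrite total-* m k (f ∘ (inside ∷_)) | total-* m k (f ∘ (outside ∷_)) =
  eq m k (total m (f ∘ (inside ∷_))) (total m (f ∘ (outside ∷_)))
  where
  eq : ∀ m k a b → k * a + m * (k * b) ≡ k * (a + m * b)
  eq = solve-∀

total-1 : ∀ m n → total m {n} (λ _ → 1) ≡ suc m ^ n
total-1 m zero    = refl
total-1 m (suc n) rewrite total-1 m n = refl

-- Linearity of expectation: each of the `n` elements contributes its probability 1/(m + 1).
total-∣∣ : ∀ m n → suc m * total m {n} ∣_∣ ≡ n * suc m ^ n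
total-∣∣ m zero    = *-zeroʳ m
total-∣∣ m (suc n) = begin
  suc m * (total m {n} (λ S → 1 + ∣ S ∣) + m * T) ≡⟨ cong (λ t → suc m * (t + m * T)) (total-+ m {n} (λ _ → 1) ∣_∣) ⟩
  suc m * (total m {n} (λ _ → 1) + T + m * T)   ≡⟨ cong (λ t → suc m * (t + T + m * T)) (total-1 m n) ⟩
  suc m * (D + T + m * T)                       ≡⟨ eq₁ m D T ⟩
  suc m * D + suc m * (suc m * T)               ≡⟨ cong (λ t → suc m * D + suc m * t) (total-∣∣ m n) ⟩
  suc m * D + suc m * (n * D)                   ≡⟨ eq₂ m n D ⟩
  suc n * (suc m * D)                           ∎
  where
  open ≡-Reasoning
  T = total m {n} ∣_∣
  D = suc m ^ n
  eq₁ : ∀ m D T → (1 + m) * (D + T + m * T) ≡ (1 + m) * D + (1 + m) * ((1 + m) * T)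
  eq₁ = solve-∀
  eq₂ : ∀ m n D → (1 + m) * D + (1 + m) * (n * D) ≡ (1 + n) * ((1 + m) * D)
  eq₂ = solve-∀

-- The method of conditional expectations: elements are decided one by one, and the better of the
-- two branch witnesses is below both conditional averages, hence below their weighted mean.
total-min : ∀ m {n} (g : Subset n → ℕ) → ∃ λ S → suc m ^ n * g S ≤ total m g
total-min m {zero}  g = [] , ≤-reflexive (*-identityˡ _)
total-min m {suc n} g with total-min m (g ∘ (inside ∷_)) | total-min m (g ∘ (outside ∷_))
... | S , gS | T , gT with ≤-total (g (inside ∷ S)) (g (outside ∷ T))
... | inj₁ le = inside ∷ S , ≤-trans (≤-reflexive (*-assoc (suc m) D _))
                  (+-mono-≤ gS (*-monoʳ-≤ m (≤-trans (*-monoʳ-≤ D le) gT)))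
  where D = suc m ^ n
... | inj₂ ge = outside ∷ T , ≤-trans (≤-reflexive (*-assoc (suc m) D _))
                  (+-mono-≤ (≤-trans (*-monoʳ-≤ D ge) gS) (*-monoʳ-≤ m gT))
  where D = suc m ^ n

-- The event I ⊆ S, F ∩ S = ∅ has probability mᶠ / (m + 1)ⁱ⁺ᶠ.
total-lower : ∀ m {n} (I F : Subset n) → (∀ {x} → x ∈ I → x ∉ F) → (g : Subset n → ℕ) →
              (∀ S → I ⊆ S → (∀ {x} → x ∈ F → x ∉ S) → 1 ≤ g S) →
              m ^ ∣ F ∣ * suc m ^ n ≤ suc m ^ (∣ I ∣ + ∣ F ∣) * total m g
total-lower m [] [] _ g hit = ≤-trans (hit [] (λ ()) (λ ())) (≤-reflexive (≡-sym (*-identityˡ _)))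
total-lower m (inside ∷ I) (inside ∷ F) I#F g hit = contradiction here (I#F here)
total-lower m {suc n} (inside ∷ I) (outside ∷ F) I#F g hit = begin
  m ^ ∣ F ∣ * (suc m * suc m ^ n)                    ≡⟨ eq (m ^ ∣ F ∣) (suc m) (suc m ^ n) ⟩
  suc m * (m ^ ∣ F ∣ * suc m ^ n)                    ≤⟨ *-monoʳ-≤ (suc m) ih ⟩
  suc m * (suc m ^ (∣ I ∣ + ∣ F ∣) * T)              ≡⟨ *-assoc (suc m) (suc m ^ (∣ I ∣ + ∣ F ∣)) T ⟨
  -- The branch that omits an element of `I` is irrelevant to the event, so its total is given away.
  suc m * suc m ^ (∣ I ∣ + ∣ F ∣) * T                ≤⟨ *-monoʳ-≤ (suc m * suc m ^ (∣ I ∣ + ∣ F ∣)) (m≤m+n T _) ⟩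
  suc m * suc m ^ (∣ I ∣ + ∣ F ∣) * total m g        ∎
  where
  open ≤-Reasoning
  T = total m (g ∘ (inside ∷_))
  ih = total-lower m I F (λ x∈I x∈F → I#F (there x∈I) (there x∈F)) (g ∘ (inside ∷_))
         λ S I⊆S F#S → hit (inside ∷ S) (s⊆s I⊆S) λ { (there x∈F) (there x∈S) → F#S x∈F x∈S }
  eq : ∀ a b c → a * (b * c) ≡ b * (a * c)
  eq = solve-∀
total-lower m {suc n} (outside ∷ I) (inside ∷ F) I#F g hit = begin
  m * m ^ ∣ F ∣ * (suc m * suc m ^ n)                ≡⟨ eq₁ m (m ^ ∣ F ∣) (suc m) (suc m ^ n) ⟩
  suc m * (m * (m ^ ∣ F ∣ * suc m ^ n))              ≤⟨ *-monoʳ-≤ (suc m) (*-monoʳ-≤ m ih) ⟩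
  suc m * (m * (suc m ^ (∣ I ∣ + ∣ F ∣) * T))        ≡⟨ eq₂ (suc m) m (suc m ^ (∣ I ∣ + ∣ F ∣)) T ⟩
  suc m ^ suc (∣ I ∣ + ∣ F ∣) * (m * T)              ≡⟨ cong (λ k → suc m ^ k * (m * T)) (+-suc ∣ I ∣ ∣ F ∣) ⟨
  suc m ^ (∣ I ∣ + suc ∣ F ∣) * (m * T)              ≤⟨ *-monoʳ-≤ (suc m ^ (∣ I ∣ + suc ∣ F ∣)) (m≤n+m (m * T) _) ⟩
  suc m ^ (∣ I ∣ + suc ∣ F ∣) * total m g            ∎
  where
  open ≤-Reasoning
  T = total m (g ∘ (outside ∷_))
  ih = total-lower m I F (λ x∈I x∈F → I#F (there x∈I) (there x∈F)) (g ∘ (outside ∷_))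
         λ S I⊆S F#S → hit (outside ∷ S) (out⊆ I⊆S) λ { here () ; (there x∈F) (there x∈S) → F#S x∈F x∈S }
  eq₁ : ∀ m a b c → m * a * (b * c) ≡ b * (m * (a * c))
  eq₁ = solve-∀
  eq₂ : ∀ d m X T → d * (m * (X * T)) ≡ d * X * (m * T)
  eq₂ = solve-∀
total-lower m {suc n} (outside ∷ I) (outside ∷ F) I#F g hit = begin
  m ^ ∣ F ∣ * (suc m * suc m ^ n)                    ≡⟨ eq₁ m (m ^ ∣ F ∣) (suc m ^ n) ⟩
  m ^ ∣ F ∣ * suc m ^ n + m * (m ^ ∣ F ∣ * suc m ^ n)
    ≤⟨ +-mono-≤ (ih inside) (*-monoʳ-≤ m (ih outside)) ⟩
  X * total m (g ∘ (inside ∷_)) + m * (X * total m (g ∘ (outside ∷_)))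
    ≡⟨ eq₂ m X (total m (g ∘ (inside ∷_))) (total m (g ∘ (outside ∷_))) ⟩
  X * total m g                                      ∎
  where
  open ≤-Reasoning
  X = suc m ^ (∣ I ∣ + ∣ F ∣)
  ih : ∀ s → m ^ ∣ F ∣ * suc m ^ n ≤ X * total m (g ∘ (s ∷_))
  ih s = total-lower m I F (λ x∈I x∈F → I#F (there x∈I) (there x∈F)) (g ∘ (s ∷_))
         λ S I⊆S F#S → hit (s ∷ S) (out⊆ I⊆S) λ { (there x∈F) (there x∈S) → F#S x∈F x∈S }
  eq₁ : ∀ m a b → a * ((1 + m) * b) ≡ a * b + m * (a * b)
  eq₁ = solve-∀
  eq₂ : ∀ m X a b → X * a + m * (X * b) ≡ X * (a + m * b)
  eq₂ = solve-∀

-- Random cliques and their coverings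

∣p∪q∣≤∣p∣+∣q∣ : ∀ {n} (p q : Subset n) → ∣ p ∪ q ∣ ≤ ∣ p ∣ + ∣ q ∣
∣p∪q∣≤∣p∣+∣q∣ []            []            = z≤n
∣p∪q∣≤∣p∣+∣q∣ (inside  ∷ p) (x ∷ q)       =
  s≤s (≤-trans (∣p∪q∣≤∣p∣+∣q∣ p q) (+-monoʳ-≤ ∣ p ∣ (∣p∣≤∣x∷p∣ x q)))
∣p∪q∣≤∣p∣+∣q∣ (outside ∷ p) (inside ∷ q)  =
  ≤-trans (s≤s (∣p∪q∣≤∣p∣+∣q∣ p q)) (≤-reflexive (≡-sym (+-suc ∣ p ∣ ∣ q ∣)))
∣p∪q∣≤∣p∣+∣q∣ (outside ∷ p) (outside ∷ q) = ∣p∪q∣≤∣p∣+∣q∣ p q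

∣⁅x⁆∪⁅y⁆∣≤2 : ∀ {n} (x y : Fin n) → ∣ ⁅ x ⁆ ∪ ⁅ y ⁆ ∣ ≤ 2
∣⁅x⁆∪⁅y⁆∣≤2 x y = ≤-trans (∣p∪q∣≤∣p∣+∣q∣ ⁅ x ⁆ ⁅ y ⁆) (≤-reflexive (cong₂ _+_ (∣⁅x⁆∣≡1 x) (∣⁅x⁆∣≡1 y)))

x∈⁅y⁆∪⁅z⁆⁻ : ∀ {n} {x : Fin n} (y z : Fin n) → x ∈ ⁅ y ⁆ ∪ ⁅ z ⁆ → x ≡ y ⊎ x ≡ z
x∈⁅y⁆∪⁅z⁆⁻ y z = Sum.map (x∈⁅y⁆⇒x≡y y) (x∈⁅y⁆⇒x≡y z) ∘ x∈p∪q⁻ ⁅ y ⁆ ⁅ z ⁆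

∈-tabulate⁺ : ∀ {n} {f : Fin n → Bool} {x} → f x ≡ true → x ∈ tabulate f
∈-tabulate⁺ {f = f} {x} fx = lookup⇒[]= x (tabulate f) (trans (lookup∘tabulate f x) fx)

∈-tabulate⁻ : ∀ {n} {f : Fin n → Bool} {x} → x ∈ tabulate f → f x ≡ true
∈-tabulate⁻ {f = f} {x} x∈ = trans (≡-sym (lookup∘tabulate f x)) ([]=⇒lookup x∈)

∈-tabulate-does⁻ : ∀ {n} {P : Fin n → Set} (P? : ∀ x → Dec (P x)) {x} → x ∈ tabulate (does ∘ P?) → P x
∈-tabulate-does⁻ P? {x} x∈ with P? x | ∈-tabulate⁻ x∈
... | yes p | _ = p

module _ {A : Set} {P : A → Set} (P? : ∀ x → Dec (P x)) where

  -- The length of a filtered singleton plays the role of an indicator variable. Splitting counts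
  -- into such summands prepares for linearity of expectation.
  length-filter-∷ : ∀ x xs → length (filter P? (x ∷ xs)) ≡ length (filter P? (x ∷ [])) + length (filter P? xs)
  length-filter-∷ x xs with P? x
  ... | yes _ = refl
  ... | no  _ = refl

  length-filter-[_]≥1 : ∀ x → P x → 1 ≤ length (filter P? (x ∷ []))
  length-filter-[ x ]≥1 p with P? x
  ... | yes _ = ≤-refl
  ... | no ¬p = contradiction p ¬p

  length-filter-[_]-dichotomy : ∀ x → length (filter P? (x ∷ [])) + length (filter (¬? ∘ P?) (x ∷ [])) ≡ 1
  length-filter-[ x ]-dichotomy with P? x
  ... | yes _ = refl
  ... | no  _ = refl

Both : ∀ {n} → Subset n → Fin n × Fin n → Set
Both C (u , v) = u ∈ C × v ∈ C

both? : ∀ {n} (C : Subset n) (e : Fin n × Fin n) → Dec (Both C e)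
both? C (u , v) = (u ∈? C) ×-dec (v ∈? C)

Both-pair : ∀ {n} (u v : Fin n) → Both (⁅ u ⁆ ∪ ⁅ v ⁆) (u , v)
Both-pair u v = x∈p∪q⁺ (inj₁ (x∈⁅x⁆ u)) , x∈p∪q⁺ (inj₂ (x∈⁅x⁆ v))

-- Each unordered pair is listed once, smaller index first, so that covering every listed pair by
-- itself has weight at most n(n - 1).
pairs : ∀ n → List (Fin n × Fin n)
pairs zero    = []
pairs (suc n) = map (zero ,_) (map suc (allFin n)) ++ map (λ (u , v) → suc u , suc v) (pairs n)

2*length-pairs : ∀ n → 2 * length (pairs (suc n)) ≡ suc n * n
2*length-pairs zero    = refl
2*length-pairs (suc n) = begin
  2 * length (pairs (2 + n))               ≡⟨ cong (2 *_) (length-++ (map (zero ,_) (map suc (allFin (suc n))))) ⟩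
  2 * (length (map (zero ,_) (map suc (allFin (suc n)))) + length (map (λ (u , v) → suc u , suc v) (pairs (suc n))))
    ≡⟨ cong (2 *_) (cong₂ _+_ length-star (length-map _ (pairs (suc n)))) ⟩
  2 * (suc n + length (pairs (suc n)))     ≡⟨ *-distribˡ-+ 2 (suc n) _ ⟩
  2 * suc n + 2 * length (pairs (suc n))   ≡⟨ cong (2 * suc n +_) (2*length-pairs n) ⟩
  2 * suc n + suc n * n                    ≡⟨ eq n ⟩
  (2 + n) * suc n                          ∎
  where
  open ≡-Reasoning
  length-star : length (map (zero {suc n} ,_) (map suc (allFin (suc n)))) ≡ suc n
  length-star = trans (length-map (zero ,_) (map suc (allFin (suc n))))
                  (trans (length-map suc (allFin (suc n))) (length-tabulate {n = suc n} id))
  eq : ∀ n → 2 * (1 + n) + (1 + n) * n ≡ (2 + n) * (1 + n)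
  eq = solve-∀

∈-pairs : ∀ {n} (u v : Fin n) → u ≢ v → (u , v) ∈ₗ pairs n ⊎ (v , u) ∈ₗ pairs n
∈-pairs zero    zero    u≢v = contradiction refl u≢v
∈-pairs zero    (suc v) _   = inj₁ (∈-++⁺ˡ (∈-map⁺ (zero ,_) (∈-map⁺ suc (∈-allFin v))))
∈-pairs (suc u) zero    _   = inj₂ (∈-++⁺ˡ (∈-map⁺ (zero ,_) (∈-map⁺ suc (∈-allFin u))))
∈-pairs {suc n} (suc u) (suc v) u≢v = Sum.map shift shift (∈-pairs u v (u≢v ∘ cong suc))
  where
  shift : ∀ {e} → e ∈ₗ pairs n → _
  shift = ∈-++⁺ʳ (map (zero ,_) (map suc (allFin n))) ∘ ∈-map⁺ (λ (u , v) → suc u , suc v)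

module _ {n : ℕ} (G : Graph n) where

  IsEdge : Fin n × Fin n → Set
  IsEdge (u , v) = Edge G u v

  edge? : ∀ e → Dec (IsEdge e)
  edge? (u , v) = adj G u v Bool.≟ true

  edges : List (Fin n × Fin n)
  edges = filter edge? (pairs n)

  Edge⇒≢ : ∀ {u v} → Edge G u v → u ≢ v
  Edge⇒≢ {u} e refl with trans (≡-sym e) (irrefl G u)
  ... | ()

  ∈-coNbhd⁺ : ∀ {u v} → adj G u v ≡ false → u ≢ v → v ∈ coNbhd G u
  ∈-coNbhd⁺ {u} {v} ¬e u≢v = ∈-tabulate⁺ (cong₂ (λ x y → not x ∧ not y) ¬e (trans (isYes≗does (u ≟ v)) (dec-false (u ≟ v) u≢v)))

  ∈-coNbhd⁻ : ∀ {u v} → v ∈ coNbhd G u → ¬ Edge G u v × u ≢ v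
  ∈-coNbhd⁻ {u} {v} v∈ with adj G u v | u ≟ v | ∈-tabulate⁻ v∈
  ... | false | no u≢v | _ = (λ ()) , u≢v

  Kept : Subset n → Fin n → Set
  Kept S v = v ∈ S × ¬ Nonempty (coNbhd G v ∩ S)

  kept? : ∀ S v → Dec (Kept S v)
  kept? S v = (v ∈? S) ×-dec ¬? (nonempty? (coNbhd G v ∩ S))

  kept : Subset n → Subset n
  kept S = tabulate (λ v → does (kept? S v))

  ∈-kept⁺ : ∀ {S v} → Kept S v → v ∈ kept S
  ∈-kept⁺ {S} {v} k = ∈-tabulate⁺ (dec-true (kept? S v) k)

  ∈-kept⁻ : ∀ {S v} → v ∈ kept S → Kept S v
  ∈-kept⁻ {S} = ∈-tabulate-does⁻ (kept? S)

  -- If `u` and `v` were not adjacent, `v` would be a chosen non-neighbour of `u`, and `u` would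
  -- have been discarded.
  kept-clique : ∀ S → IsClique G (kept S)
  kept-clique S u v u∈ v∈ u≢v with adj G u v in eq
  ... | true  = refl
  ... | false = contradiction (v , x∈p∩q⁺ (∈-coNbhd⁺ eq u≢v , proj₁ (∈-kept⁻ v∈))) (proj₂ (∈-kept⁻ u∈))

  ∣kept∣≤ : ∀ S → ∣ kept S ∣ ≤ ∣ S ∣
  ∣kept∣≤ S = p⊆q⇒∣p∣≤∣q∣ (proj₁ ∘ ∈-kept⁻)

  missed : Subset n → List (Fin n × Fin n) → List (Fin n × Fin n)
  missed S = filter (λ e → ¬? (both? (kept S) e))

  pair-clique : ∀ {u v} → Edge G u v → IsClique G (⁅ u ⁆ ∪ ⁅ v ⁆)
  pair-clique {u} {v} e x y x∈ y∈ x≢y with x∈⁅y⁆∪⁅z⁆⁻ u v x∈ | x∈⁅y⁆∪⁅z⁆⁻ u v y∈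
  ... | inj₁ refl | inj₁ refl = contradiction refl x≢y
  ... | inj₁ refl | inj₂ refl = e
  ... | inj₂ refl | inj₁ refl = trans (sym G v u) e
  ... | inj₂ refl | inj₂ refl = contradiction refl x≢y

  -- Relative to a list `U` of pairs, so that the induction over rounds can pass to the pairs still
  -- missed.
  Covers : List (Subset n) → List (Fin n × Fin n) → Set
  Covers 𝒞 U = All (IsClique G) 𝒞 × All (λ e → Any (λ C → Both C e) 𝒞) U

  cover-by-pairs : ∀ {U} → All IsEdge U → ∃ λ 𝒞 → Covers 𝒞 U × weight 𝒞 ≤ 2 * length U
  cover-by-pairs [] = [] , ([] , []) , z≤n
  cover-by-pairs {(u , v) ∷ U} (e ∷ es) with cover-by-pairs es
  ... | 𝒞 , (cliques , covered) , w≤ =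
    (⁅ u ⁆ ∪ ⁅ v ⁆) ∷ 𝒞 ,
    (pair-clique e ∷ cliques , here (Both-pair u v) ∷ All.map there covered) ,
    ≤-trans (+-mono-≤ (∣⁅x⁆∪⁅y⁆∣≤2 u v) w≤) (≤-reflexive (≡-sym (*-distribˡ-+ 2 1 (length U))))

  cover-missed : ∀ S {𝒞 U} → Covers 𝒞 (missed S U) → Covers (kept S ∷ 𝒞) U
  cover-missed S {𝒞} {U} (cliques , covered) = kept-clique S ∷ cliques , All.tabulate cover
    where
    cover : ∀ {e} → e ∈ₗ U → Any (λ C → Both C e) (kept S ∷ 𝒞)
    cover {e} e∈U with both? (kept S) e
    ... | yes b = here b
    ... | no ¬b = there (All.lookup covered (∈-filter⁺ (λ e → ¬? (both? (kept S) e)) e∈U ¬b))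

  Covers-edges⇒IsCliqueCovering : ∀ {𝒞} → Covers 𝒞 edges → IsCliqueCovering G 𝒞
  Covers-edges⇒IsCliqueCovering {𝒞} (cliques , covered) = cliques , cover
    where
    cover : ∀ u v → Edge G u v → Any (λ C → u ∈ C × v ∈ C) 𝒞
    cover u v e with ∈-pairs u v (Edge⇒≢ e)
    ... | inj₁ uv∈ = All.lookup covered (∈-filter⁺ edge? uv∈ e)
    ... | inj₂ vu∈ = Any.map swap (All.lookup covered (∈-filter⁺ edge? vu∈ (trans (sym G v u) e)))

  -- One derandomised round and its iteration

  module _ (m : ℕ) (coDeg≤m : ∀ u → coDeg G u ≤ m) where

    private
      D = suc m ^ n

    -- Both ends have to be chosen and their at most 2m non-neighbours avoided.
    kept-both-lower : ∀ {u v} → Edge G u v → (g : Subset n → ℕ) → (∀ S → Both (kept S) (u , v) → 1 ≤ g S) →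
                      m ^ (2 * m) * D ≤ suc m ^ (2 * suc m) * total m g
    kept-both-lower {u} {v} e g hit = begin
      m ^ (2 * m) * D                               ≡⟨ cong (λ k → m ^ k * D) (m∸n+n≡m F≤) ⟨
      m ^ (2 * m ∸ ∣ F ∣ + ∣ F ∣) * D               ≡⟨ cong (_* D) (^-distribˡ-+-* m (2 * m ∸ ∣ F ∣) ∣ F ∣) ⟩
      m ^ (2 * m ∸ ∣ F ∣) * m ^ ∣ F ∣ * D           ≡⟨ *-assoc (m ^ (2 * m ∸ ∣ F ∣)) _ _ ⟩
      -- `F` may have fewer than 2m elements. Each missing one is made up for by m ≤ m + 1, which
      -- gives the same bound for every edge.
      m ^ (2 * m ∸ ∣ F ∣) * (m ^ ∣ F ∣ * D)         ≤⟨ *-mono-≤ (^-monoˡ-≤ (2 * m ∸ ∣ F ∣) (n≤1+n m)) (total-lower m I F I#F g hit′) ⟩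
      suc m ^ (2 * m ∸ ∣ F ∣) * (suc m ^ (∣ I ∣ + ∣ F ∣) * T) ≡⟨ *-assoc (suc m ^ (2 * m ∸ ∣ F ∣)) _ T ⟨
      suc m ^ (2 * m ∸ ∣ F ∣) * suc m ^ (∣ I ∣ + ∣ F ∣) * T   ≡⟨ cong (_* T) (^-distribˡ-+-* (suc m) (2 * m ∸ ∣ F ∣) (∣ I ∣ + ∣ F ∣)) ⟨
      suc m ^ (2 * m ∸ ∣ F ∣ + (∣ I ∣ + ∣ F ∣)) * T ≤⟨ *-monoˡ-≤ T (^-monoʳ-≤ (suc m) exponent≤) ⟩
      suc m ^ (2 * suc m) * T                       ∎
      where
      open ≤-Reasoning
      I = ⁅ u ⁆ ∪ ⁅ v ⁆
      F = coNbhd G u ∪ coNbhd G v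
      T = total m g

      F≤ : ∣ F ∣ ≤ 2 * m
      F≤ = ≤-trans (∣p∪q∣≤∣p∣+∣q∣ (coNbhd G u) (coNbhd G v))
             (+-mono-≤ (coDeg≤m u) (≤-trans (coDeg≤m v) (m≤m+n m 0)))

      exponent≤ : 2 * m ∸ ∣ F ∣ + (∣ I ∣ + ∣ F ∣) ≤ 2 * suc m
      exponent≤ = begin
        2 * m ∸ ∣ F ∣ + (∣ I ∣ + ∣ F ∣) ≡⟨ eq (2 * m ∸ ∣ F ∣) ∣ I ∣ ∣ F ∣ ⟩
        ∣ I ∣ + (2 * m ∸ ∣ F ∣ + ∣ F ∣) ≡⟨ cong (∣ I ∣ +_) (m∸n+n≡m F≤) ⟩
        ∣ I ∣ + 2 * m                   ≤⟨ +-monoˡ-≤ (2 * m) (∣⁅x⁆∪⁅y⁆∣≤2 u v) ⟩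
        2 + 2 * m                       ≡⟨ *-suc 2 m ⟨
        2 * suc m                       ∎
        where
        eq : ∀ x y z → x + (y + z) ≡ y + (x + z)
        eq = solve-∀

      -- Adjacency of `u` and `v` matters here: neither end may have to be avoided on account of the
      -- other.
      I#F : ∀ {x} → x ∈ I → x ∉ F
      I#F x∈I x∈F with x∈⁅y⁆∪⁅z⁆⁻ u v x∈I | x∈p∪q⁻ (coNbhd G u) (coNbhd G v) x∈F
      ... | inj₁ refl | inj₁ ∈u = proj₂ (∈-coNbhd⁻ ∈u) refl
      ... | inj₁ refl | inj₂ ∈v = proj₁ (∈-coNbhd⁻ ∈v) (trans (sym G v u) e)
      ... | inj₂ refl | inj₁ ∈u = proj₁ (∈-coNbhd⁻ ∈u) e
      ... | inj₂ refl | inj₂ ∈v = proj₂ (∈-coNbhd⁻ ∈v) refl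

      hit′ : ∀ S → I ⊆ S → (∀ {x} → x ∈ F → x ∉ S) → 1 ≤ g S
      hit′ S I⊆S F#S = hit S
        ( ∈-kept⁺ (I⊆S (proj₁ (Both-pair u v)) , isolated u (x∈p∪q⁺ ∘ inj₁))
        , ∈-kept⁺ (I⊆S (proj₂ (Both-pair u v)) , isolated v (x∈p∪q⁺ ∘ inj₂)) )
        where
        isolated : ∀ w → coNbhd G w ⊆ F → ¬ Nonempty (coNbhd G w ∩ S)
        isolated w coNbhd⊆F (x , x∈) = let x∈w , x∈S = x∈p∩q⁻ (coNbhd G w) S x∈ in F#S (coNbhd⊆F x∈w) x∈S

    -- The fraction a/b is the bound q on the success probability, and c/b is 1 - q. Both are
    -- variables tied down by equations, so that the ring solver sees atoms instead of powers.
    module _ (a b c : ℕ) (a≡ : a ≡ m ^ (2 * m)) (b≡ : b ≡ suc m ^ (2 * suc m)) (a+c≡b : a + c ≡ b) where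

      -- Passage to the complementary event: the indicators of hit and miss add up to 1. Cancelling
      -- `a * D` replaces a subtraction.
      total-missed-edge : ∀ {e} → IsEdge e → b * total m (λ S → length (missed S (e ∷ []))) ≤ c * D
      total-missed-edge {e} ise = +-cancelˡ-≤ (a * D) _ _ (begin
        a * D + b * total m miss              ≤⟨ +-monoˡ-≤ _ hit-lower ⟩
        b * total m hit + b * total m miss    ≡⟨ *-distribˡ-+ b (total m hit) (total m miss) ⟨
        b * (total m hit + total m miss)      ≡⟨ cong (b *_) (total-+ m hit miss) ⟨
        b * total m (λ S → hit S + miss S)    ≤⟨ *-monoʳ-≤ b (total-mono-≤ m (λ S → ≤-reflexive (length-filter-[_]-dichotomy (both? (kept S)) e))) ⟩
        b * total m {n} (λ _ → 1)             ≡⟨ cong (b *_) (total-1 m n) ⟩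
        b * D                                 ≡⟨ cong (_* D) a+c≡b ⟨
        (a + c) * D                           ≡⟨ *-distribʳ-+ D a c ⟩
        a * D + c * D                         ∎)
        where
        open ≤-Reasoning
        hit miss : Subset n → ℕ
        hit  S = length (filter (both? (kept S)) (e ∷ []))
        miss S = length (missed S (e ∷ []))
        hit-lower : a * D ≤ b * total m hit
        hit-lower = subst₂ (λ x y → x * D ≤ y * total m hit) (≡-sym a≡) (≡-sym b≡)
                      (kept-both-lower ise hit λ S → length-filter-[_]≥1 (both? (kept S)) e)

      total-missed : ∀ {U} → All IsEdge U → b * total m (λ S → length (missed S U)) ≤ c * D * length U
      total-missed [] = ≤-reflexive (trans (cong (b *_) (total-* m 0 {n} (λ _ → 0))) (trans (*-zeroʳ b) (≡-sym (*-zeroʳ (c * D)))))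
      total-missed {e ∷ U} (ise ∷ es) = begin
        b * total m (λ S → length (missed S (e ∷ U)))
          ≤⟨ *-monoʳ-≤ b (total-mono-≤ m (λ S → ≤-reflexive (length-filter-∷ (λ e → ¬? (both? (kept S) e)) e U))) ⟩
        b * total m (λ S → length (missed S (e ∷ [])) + length (missed S U))
          ≡⟨ cong (b *_) (total-+ m (λ S → length (missed S (e ∷ []))) (λ S → length (missed S U))) ⟩
        b * (total m (λ S → length (missed S (e ∷ []))) + total m (λ S → length (missed S U)))
          ≡⟨ *-distribˡ-+ b (total m (λ S → length (missed S (e ∷ [])))) _ ⟩
        b * total m (λ S → length (missed S (e ∷ []))) + b * total m (λ S → length (missed S U))
          ≤⟨ +-mono-≤ (total-missed-edge ise) (total-missed es) ⟩
        c * D + c * D * length U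
          ≡⟨ *-suc (c * D) (length U) ⟨
        c * D * length (e ∷ U) ∎
        where open ≤-Reasoning

      -- A single `S` must keep both the clique and the missed edges under control, so a weighted
      -- sum of the two is averaged. The weights stay free, because the price of a missed edge
      -- depends on how many rounds remain.
      good-subset : ∀ x y {U} → All IsEdge U → ∃ λ S →
                    suc m * x * ∣ kept S ∣ + y * b * length (missed S U) ≤ n * x + y * c * length U
      good-subset x y {U} es = map₂ (λ {S} le → *-cancelˡ-≤ D {{m^n≢0 (suc m) n}} (≤-trans le total-cost≤)) (total-min m cost)
        where
        open ≤-Reasoning
        cost : Subset n → ℕ
        cost S = suc m * x * ∣ kept S ∣ + y * b * length (missed S U)
        K = total m {n} (λ S → ∣ kept S ∣)
        M = total m (λ S → length (missed S U))
        eq₁ : ∀ d x K y b M → d * x * K + y * b * M ≡ x * (d * K) + y * (b * M)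
        eq₁ = solve-∀
        eq₂ : ∀ x n D y c l → x * (n * D) + y * (c * D * l) ≡ D * (n * x + y * c * l)
        eq₂ = solve-∀
        total-cost≤ : total m cost ≤ D * (n * x + y * c * length U)
        total-cost≤ = begin
          total m cost                         ≡⟨ total-+ m (λ S → suc m * x * ∣ kept S ∣) (λ S → y * b * length (missed S U)) ⟩
          total m (λ S → suc m * x * ∣ kept S ∣) + total m (λ S → y * b * length (missed S U))
            ≡⟨ cong₂ _+_ (total-* m (suc m * x) (λ S → ∣ kept S ∣)) (total-* m (y * b) (λ S → length (missed S U))) ⟩
          suc m * x * K + y * b * M            ≡⟨ eq₁ (suc m) x K y b M ⟩
          x * (suc m * K) + y * (b * M)        ≤⟨ +-mono-≤ (*-monoʳ-≤ x (*-monoʳ-≤ (suc m) (total-mono-≤ m ∣kept∣≤))) (*-monoʳ-≤ y (total-missed es)) ⟩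
          x * (suc m * total m {n} ∣_∣) + y * (c * D * length U)
                                               ≡⟨ cong (λ z → x * z + y * (c * D * length U)) (total-∣∣ m n) ⟩
          x * (n * D) + y * (c * D * length U) ≡⟨ eq₂ x n D y c (length U) ⟩
          D * (n * x + y * c * length U)       ∎

      -- The bound W ≤ t n / d + 2 (c / b)ᵗ |U|, cleared of denominators.
      cover-in-rounds : ∀ t {U} → All IsEdge U → ∃ λ 𝒞 → Covers 𝒞 U ×
                        suc m * b ^ t * weight 𝒞 ≤ t * n * b ^ t + 2 * suc m * c ^ t * length U
      cover-in-rounds zero {U} es with cover-by-pairs es
      ... | 𝒞 , covers , w≤ = 𝒞 , covers , (begin
        suc m * 1 * weight 𝒞       ≤⟨ *-monoʳ-≤ (suc m * 1) w≤ ⟩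
        suc m * 1 * (2 * length U) ≡⟨ eq (suc m) (length U) ⟩
        2 * suc m * 1 * length U   ∎)
        where
        open ≤-Reasoning
        eq : ∀ d l → d * 1 * (2 * l) ≡ 2 * d * 1 * l
        eq = solve-∀
      -- An edge missed now is charged 2(c/b)ᵗ, its price with t rounds to go. With these weights
      -- the cost is that of `kept S` plus these charges, multiplied by the common denominator
      -- `suc m * b ^ suc t`.
      cover-in-rounds (suc t) {U} es with good-subset (b * b ^ t) (2 * suc m * c ^ t) es
      ... | S , cost≤ with cover-in-rounds t (All.filter⁺ (λ e → ¬? (both? (kept S) e)) es)
      ... | 𝒞 , covers , w≤ = kept S ∷ 𝒞 , cover-missed S covers , (begin
        suc m * (b * B) * (k + w)                              ≡⟨ eq₁ (suc m) b B k w ⟩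
        suc m * (b * B) * k + b * (suc m * B * w)              ≤⟨ +-monoʳ-≤ (suc m * (b * B) * k) (*-monoʳ-≤ b w≤) ⟩
        suc m * (b * B) * k + b * (t * n * B + y * l)          ≡⟨ eq₂ (suc m * (b * B) * k) b (t * n) B y l ⟩
        suc m * (b * B) * k + y * b * l + t * n * (b * B)      ≤⟨ +-monoˡ-≤ (t * n * (b * B)) cost≤ ⟩
        n * (b * B) + y * c * length U + t * n * (b * B)       ≡⟨ eq₃ n (b * B) (suc m) (c ^ t) c (length U) t ⟩
        suc t * n * (b * B) + 2 * suc m * (c * c ^ t) * length U ∎)
        where
        open ≤-Reasoning
        B = b ^ t
        k = ∣ kept S ∣
        w = weight 𝒞
        y = 2 * suc m * c ^ t
        l = length (missed S U)
        eq₁ : ∀ d b B k w → d * (b * B) * (k + w) ≡ d * (b * B) * k + b * (d * B * w)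
        eq₁ = solve-∀
        eq₂ : ∀ z b tn B y l → z + b * (tn * B + y * l) ≡ z + y * b * l + tn * (b * B)
        eq₂ = solve-∀
        eq₃ : ∀ n B d C c l t → n * B + 2 * d * C * c * l + t * n * B ≡ (1 + t) * n * B + 2 * d * (c * C) * l
        eq₃ = solve-∀

  -- Both `u` and one of its neighbours lie outside `coNbhd G u`; the neighbour makes the inclusion
  -- in `⊤ - u` strict.
  2+coDeg≤n : NoIsolated G → ∀ u → 2 + coDeg G u ≤ n
  2+coDeg≤n noIsolated u with noIsolated u
  ... | v , e = begin
    2 + coDeg G u     ≤⟨ s≤s (p⊂q⇒∣p∣<∣q∣ coNbhd⊂) ⟩
    1 + ∣ ⊤ {n} - u ∣ ≤⟨ x∈p⇒∣p-x∣<∣p∣ (∈⊤ {x = u}) ⟩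
    ∣ ⊤ {n} ∣         ≡⟨ ∣⊤∣≡n n ⟩
    n                 ∎
    where
    open ≤-Reasoning
    coNbhd⊂ : coNbhd G u ⊂ ⊤ - u
    coNbhd⊂ = (λ w∈ → x∈p∧x≢y⇒x∈p-y ∈⊤ (proj₂ (∈-coNbhd⁻ w∈) ∘ ≡-sym)) ,
              v , x∈p∧x≢y⇒x∈p-y ∈⊤ (Edge⇒≢ e ∘ ≡-sym) , λ v∈ → proj₁ (∈-coNbhd⁻ v∈) e

-- The number of rounds and the final estimate

2*∣edges∣≤ : ∀ {n} (G : Graph (suc n)) → 2 * length (edges G) ≤ suc n * n
2*∣edges∣≤ {n} G = ≤-trans (*-monoʳ-≤ 2 (length-filter (edge? G) (pairs (suc n)))) (≤-reflexive (2*length-pairs n))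

-- All partial sums of e⁰ are 1, so L = 0 would force n ≤ m. But a vertex of co-degree `m` has a
-- neighbour, so the n + 1 vertices number at least m + 2.
0<⌈ln⌉ : ∀ {n m L} (G : Graph (suc n)) → NoIsolated G → (∃ λ u → coDeg G u ≡ m) → FracLeExp n m L → 0 < L
0<⌈ln⌉ {L = suc L} _ _ _ _ = s≤s z≤n
0<⌈ln⌉ {n} {m} {zero} G noIsolated (u , coDeg≡) le with FracLeExp⇒≤ {n} {m} {0} le
... | N , bound = contradiction n≤m (<⇒≱ (s≤s⁻¹ (subst (λ k → 2 + k ≤ suc n) coDeg≡ (2+coDeg≤n G noIsolated u))))
  where
  expSum-1-0 : expSum 1 N 0 ≡ N !
  expSum-1-0 = trans (expSum-0 1 N) (trans (cong (N ! *_) (^-zeroˡ N)) (*-identityʳ (N !)))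
  n≤m : n ≤ m
  n≤m = *-cancelʳ-≤ n m (N !) {{N !≢0}} (subst (λ z → n * N ! ≤ m * z) expSum-1-0 bound)

-- The left-over edges cost 2(c/b)ᵗ l, which is at most n n′ (c/b)ᵗ and hence at most nm.
rounds-weight : ∀ {m n n′ t b c W l} .{{_ : NonZero b}} → suc m * b ^ t * W ≤ t * n * b ^ t + 2 * suc m * c ^ t * l →
                2 * l ≤ n * n′ → c ^ t * n′ ≤ b ^ t * m → suc m * W ≤ t * n + suc m * n * m
rounds-weight {m} {n} {n′} {t} {b} {c} {W} {l} w≤ l≤ decay = *-cancelˡ-≤ (b ^ t) {{m^n≢0 b t}} (begin
  b ^ t * (suc m * W)                              ≡⟨ eq₁ (b ^ t) (suc m) W ⟩
  suc m * b ^ t * W                                ≤⟨ w≤ ⟩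
  t * n * b ^ t + 2 * suc m * c ^ t * l            ≡⟨ eq₂ (t * n * b ^ t) (suc m) (c ^ t) l ⟩
  t * n * b ^ t + suc m * c ^ t * (2 * l)          ≤⟨ +-monoʳ-≤ (t * n * b ^ t) (*-monoʳ-≤ (suc m * c ^ t) l≤) ⟩
  t * n * b ^ t + suc m * c ^ t * (n * n′)         ≡⟨ eq₃ (t * n * b ^ t) (suc m) (c ^ t) n n′ ⟩
  t * n * b ^ t + suc m * n * (c ^ t * n′)         ≤⟨ +-monoʳ-≤ (t * n * b ^ t) (*-monoʳ-≤ (suc m * n) decay) ⟩
  t * n * b ^ t + suc m * n * (b ^ t * m)          ≡⟨ eq₄ (t * n) (b ^ t) (suc m) n m ⟩
  b ^ t * (t * n + suc m * n * m)                  ∎)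
  where
  open ≤-Reasoning
  eq₁ : ∀ B d W → B * (d * W) ≡ d * B * W
  eq₁ = solve-∀
  eq₂ : ∀ z d C l → z + 2 * d * C * l ≡ z + d * C * (2 * l)
  eq₂ = solve-∀
  eq₃ : ∀ z d C n k → z + d * C * (n * k) ≡ z + d * n * (C * k)
  eq₃ = solve-∀
  eq₄ : ∀ tn B d n m → tn * B + d * n * (B * m) ≡ B * (tn + d * n * m)
  eq₄ = solve-∀

-- Read A/F as a partial sum S of e², and let d = m + 1. Then b/a ≤ d² S and t ≤ L b/a + 1, so the
-- rounds cost t n/d ≤ n d L S + n/d. The summand 1 in e² + 1 pays for n/d and for the left-over
-- edges.
weight-bound : ∀ {a b m n L t W A F X} .{{_ : NonZero a}} → suc m * W ≤ t * n + suc m * n * m →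
               t * a ≤ L * b + a → b ≡ suc m * (suc m * X) → F * X ≤ a * A → 0 < L →
               W * F ≤ (A + F) * (n * suc m * L)
weight-bound {a} {b} {m} {n} {L} {t} {W} {A} {F} {X} w≤ ta≤ refl FX≤ 0<L = *-cancelˡ-≤ (a * d) {{m*n≢0 a d}} (begin
  a * d * (W * F)                                       ≡⟨ eq₁ a d W F ⟩
  a * F * (d * W)                                       ≤⟨ *-monoʳ-≤ (a * F) w≤ ⟩
  a * F * (t * n + d * n * m)                           ≡⟨ eq₂ a F t n d m ⟩
  F * n * (t * a) + a * F * n * (d * m)                 ≤⟨ +-monoˡ-≤ _ (*-monoʳ-≤ (F * n) ta≤) ⟩
  F * n * (L * b + a) + a * F * n * (d * m)             ≡⟨ eq₃ F n L d X a m ⟩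
  n * L * d * d * (F * X) + a * F * n * (1 + d * m)     ≤⟨ +-mono-≤ (*-monoʳ-≤ (n * L * d * d) FX≤) (*-monoʳ-≤ (a * F * n) 1+dm≤ddL) ⟩
  n * L * d * d * (a * A) + a * F * n * (d * d * L)     ≡⟨ eq₄ n L d a A F ⟩
  a * d * ((A + F) * (n * d * L))                       ∎)
  where
  open ≤-Reasoning
  d = suc m
  -- Multiplied by n/d, the left side is the rounding loss n/d plus the left-over cost nm, and the
  -- right side is n d L.
  1+dm≤ddL : 1 + d * m ≤ d * d * L
  1+dm≤ddL = begin
    1 + d * m ≤⟨ +-monoˡ-≤ (d * m) {1} {d} (s≤s z≤n) ⟩
    d + d * m ≡⟨ *-suc d m ⟨
    d * d     ≡⟨ *-identityʳ (d * d) ⟨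
    d * d * 1 ≤⟨ *-monoʳ-≤ (d * d) 0<L ⟩
    d * d * L ∎
  eq₁ : ∀ a d W F → a * d * (W * F) ≡ a * F * (d * W)
  eq₁ = solve-∀
  eq₂ : ∀ a F t n d m → a * F * (t * n + d * n * m) ≡ F * n * (t * a) + a * F * n * (d * m)
  eq₂ = solve-∀
  eq₃ : ∀ F n L d X a m → F * n * (L * (d * (d * X)) + a) + a * F * n * (d * m) ≡ n * L * d * d * (F * X) + a * F * n * (1 + d * m)
  eq₃ = solve-∀
  eq₄ : ∀ n L d a A F → n * L * d * d * (a * A) + a * F * n * (d * d * L) ≡ a * d * ((A + F) * (n * d * L))
  eq₄ = solve-∀

-- The degree `N` is dictated by the hypothesis on `L`. Since `exp-decay` holds in every degree, the
-- same partial sum appears in both inequalities and can be eliminated.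
exp-decay-FracLeExp : ∀ {n′ m a b c L t} .{{_ : NonZero b}} → FracLeExp n′ m L → a + c ≡ b → L * b ≤ t * a →
                      c ^ t * n′ ≤ b ^ t * m
exp-decay-FracLeExp {n′} {m} {a} {b} {c} {L} {t} le refl Lb≤ta with FracLeExp⇒≤ {n′} {m} {L} le
... | N , n′N!≤ = *-cancelʳ-≤ _ _ (N !) {{N !≢0}} (begin
  c ^ t * n′ * N !             ≡⟨ *-assoc (c ^ t) n′ (N !) ⟩
  c ^ t * (n′ * N !)           ≤⟨ *-monoʳ-≤ (c ^ t) n′N!≤ ⟩
  c ^ t * (m * expSum 1 N L)   ≡⟨ eq₁ (c ^ t) m (expSum 1 N L) ⟩
  m * (c ^ t * expSum 1 N L)   ≤⟨ *-monoʳ-≤ m (exp-decay a c L N t Lb≤ta) ⟩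
  m * (b ^ t * N !)            ≡⟨ eq₂ m (b ^ t) (N !) ⟩
  b ^ t * m * N !              ∎)
  where
  open ≤-Reasoning
  eq₁ : ∀ C m P → C * (m * P) ≡ m * (C * P)
  eq₁ = solve-∀
  eq₂ : ∀ m B F → m * (B * F) ≡ B * m * F
  eq₂ = solve-∀

-- For k = L b this fixes the number t of rounds: the lower bound feeds the decay, the upper bound
-- the weight estimate.
least-multiple-above : ∀ k a .{{_ : NonZero a}} → ∃ λ t → k ≤ t * a × t * a ≤ k + a
least-multiple-above k a = suc (k / a) ,
  ≤-trans (≤-reflexive (m≡m%n+[m/n]*n k a)) (+-monoˡ-≤ (k / a * a) (<⇒≤ (m%n<n k a))) ,
  ≤-trans (≤-reflexive (+-comm a _)) (+-monoˡ-≤ a (m/n*n≤m k a))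

scc-bounded : ∀ {n′} m (G : Graph (suc n′)) → NoIsolated G → MaxCoDegIs G m → ∀ L → FracLeExp n′ m L →
              ∀ {a b} .{{_ : NonZero a}} .{{_ : NonZero b}} → a ≡ m ^ (2 * m) → b ≡ suc m ^ (2 * suc m) → a ≤ b →
              SccBounded G (λ s → LeE2Plus1Times s (suc n′ * suc m * L))
scc-bounded {n′} m G noIsolated (coDeg≤m , attained) L n′/m≤e^L {a} {b} a≡ b≡ a≤b
  with least-multiple-above (L * b) a
... | t , Lb≤ta , ta≤Lb+a
  with cover-in-rounds G m coDeg≤m a b (b ∸ a) a≡ b≡ (m+[n∸m]≡n a≤b) t (All.all-filter (edge? G) (pairs (suc n′)))
... | 𝒞 , covers , w≤ =
  𝒞 , Covers-edges⇒IsCliqueCovering G covers ,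
  -- The partial sum of e² of degree 2m is the one that `[1+1/m]^2m≤exp2` provides.
  ≤⇒LeE2Plus1Times {weight 𝒞} {suc n′ * suc m * L} (2 * m)
    (weight-bound {a} {b} {m} {suc n′} {L} {t} {weight 𝒞}
      (rounds-weight {m} {suc n′} {n′} {t} {b} {b ∸ a} {weight 𝒞} w≤ (2*∣edges∣≤ G)
        (exp-decay-FracLeExp {n′} {m} {a} {b} {b ∸ a} {L} {t} n′/m≤e^L (m+[n∸m]≡n a≤b) Lb≤ta))
      ta≤Lb+a
      (trans b≡ (cong (suc m ^_) (*-suc 2 m)))
      (subst (λ z → (2 * m) ! * suc m ^ (2 * m) ≤ z * expSum 1 (2 * m) 2) (≡-sym a≡) ([1+1/m]^2m≤exp2 m))
      (0<⌈ln⌉ {n′} {m} G noIsolated attained n′/m≤e^L))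

theorem3 : (n d : ℕ) → 2 ≤ n → 2 ≤ d → (G : Graph n) → NoIsolated G → MaxCoDegIs G (d ∸ 1) → (L : ℕ) → IsCeilLn (n ∸ 1) (d ∸ 1) L → SccBounded G (λ s → LeE2Plus1Times s (n * d * L))
theorem3 (suc n′) (suc m) _ (s≤s 1≤m) G noIsolated maxCoDeg L (n′/m≤e^L , _) =
  scc-bounded m G noIsolated maxCoDeg L n′/m≤e^L
    -- The assumption 2 ≤ d amounts to m ≥ 1, which makes the success bound a/b positive.
    {{m^n≢0 m (2 * m) {{>-nonZero 1≤m}}}} {{m^n≢0 (suc m) (2 * suc m)}} refl refl
    (≤-trans (^-monoˡ-≤ (2 * m) (n≤1+n m)) (^-monoʳ-≤ (suc m) (*-monoʳ-≤ 2 (n≤1+n m))))
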